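{- The following lower bounds hold for the maximum order $C(d,2)$ of a Cayley graph of degree $d$ and diameter two: $C(16,2)\geq 200$, $C(21,2)\geq 288$, $C(23,2)\geq 392$, $C(28,2)\geq 512$, $C(31,2)\geq 648$, $C(37,2)\geq 800$, $C(40,2)\geq 968$, $C(46,2)\geq 1152$, $C(49,2)\geq 1352$, $C(54,2)\geq 1568$.
   Context: For a finite group $\Gamma$ and a generating set $X$ of $\Gamma$ that is unit-free (does not contain the identity) and inverse-closed ($X=X^{ -1}$), the Cayley graph $Cay(\Gamma,X)$ is the undirected simple graph with vertex set $\Gamma$ and edge set $\{\{g,h\} : g\in\Gamma,\ g^{ -1}h\in X\}$. Its degree is $|X|$ and its order is its number of vertices $|\Gamma|$. The diameter of a graph is the maximum distance between two of its vertices. For a positive integer $d$, $C(d,2)$ denotes the maximum order of a Cayley graph of a finite group having degree $d$ and diameter two (orders of such graphs are bounded above by the Moore bound $d^2+1$). -}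

module Defs where

open import Algebra.Bundles using (Group)
import Algebra.Properties.Group as GroupProperties
open import Data.Fin using (Fin; zero; suc; combine; remQuot)
open import Data.Fin.Properties as Fin using (any?; all?)
open import Data.Nat using (ℕ; zero; suc; _*_; _≤_; z≤n; s≤s)
open import Data.Nat.Properties as ℕ using (≤-refl; m≤n⇒m<n∨m≡n)
open import Data.Product using (Σ-syntax; ∃; ∃₂; _×_; _,_; proj₁; proj₂)
open import Data.Sum using (_⊎_; inj₁; inj₂)
open import Data.Vec using (Vec; []; _∷_; lookup; tabulate)
open import Data.Vec.Properties using (lookup∘tabulate)
open import Function.Base using (_∘_)
open import Function.Bundles using (Inverse)
open import Level as Level using (0ℓ)
open import Relation.Binary.Bundles using (Setoid)
open import Relation.Binary.Core using (Rel)
import Relation.Binary.Construct.On as On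
open import Relation.Binary.Definitions
  using (Symmetric; Irreflexive; _Respects_; _Respects₂_) renaming (Decidable to Decidable₂)
open import Relation.Binary.PropositionalEquality as ≡
  using (_≡_; _≢_; refl; cong; cong₂; subst)
import Relation.Binary.Reasoning.Setoid as SetoidReasoning
open import Relation.Nullary using (¬_; Dec; yes; no; contradiction)
open import Relation.Nullary.Decidable using (map′; ¬?; _×-dec_; _⊎-dec_; _→-dec_)
open import Relation.Unary using (Pred; Decidable; _∈_; _∉_)

HasSize : Setoid 0ℓ 0ℓ → ℕ → Set
HasSize S n = Inverse S (≡.setoid (Fin n))

record Graph : Set₁ where
  field
    vertices : Setoid 0ℓ 0ℓ
  open Setoid vertices public using (_≈_) renaming (Carrier to Vertex)
  field
    _~_      : Rel Vertex 0ℓ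
    ~-resp-≈ : _~_ Respects₂ _≈_
    ~-sym    : Symmetric _~_
    ~-irrefl : Irreflexive _≈_ _~_

module _ (G : Graph) where
  open Graph G

  HasOrder : ℕ → Set
  HasOrder = HasSize vertices

  data Walk : ℕ → Vertex → Vertex → Set where
    nil  : ∀ {u v} → u ≈ v → Walk 0 u v
    cons : ∀ {k u v w} → u ~ v → Walk k v w → Walk (suc k) u w

  Distance : Vertex → Vertex → ℕ → Set
  Distance u v k = Walk k u v × (∀ {j} → Walk j u v → k ≤ j)

  HasDiameter : ℕ → Set
  HasDiameter D = (∀ u v → ∃ λ k → Distance u v k × k ≤ D)
                × (∃₂ λ u v → Distance u v D)

module _ (Γ : Group 0ℓ 0ℓ) where
  open Group Γ

  data ⟨_⟩ (X : Pred Carrier 0ℓ) : Pred Carrier 0ℓ where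
    gen  : ∀ {g} → g ∈ X → g ∈ ⟨ X ⟩
    unit : ε ∈ ⟨ X ⟩
    mul  : ∀ {g h} → g ∈ ⟨ X ⟩ → h ∈ ⟨ X ⟩ → g ∙ h ∈ ⟨ X ⟩
    inv  : ∀ {g} → g ∈ ⟨ X ⟩ → g ⁻¹ ∈ ⟨ X ⟩
    resp : ∀ {g h} → g ≈ h → g ∈ ⟨ X ⟩ → h ∈ ⟨ X ⟩

  record ConnectionSet : Set₁ where
    field
      X              : Pred Carrier 0ℓ
      X-resp-≈       : X Respects _≈_
      generating     : ∀ g → g ∈ ⟨ X ⟩
      unit-free      : ε ∉ X
      inverse-closed : ∀ {g} → g ∈ X → g ⁻¹ ∈ X

    elements : Setoid 0ℓ 0ℓ
    elements = On.setoid setoid (proj₁ {B = X})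

module _ (Γ : Group 0ℓ 0ℓ) (S : ConnectionSet Γ) where
  open Group Γ renaming (refl to ≈-refl; sym to ≈-sym; trans to ≈-trans)
  open GroupProperties Γ using (⁻¹-anti-homo-∙; ⁻¹-involutive)
  open ConnectionSet S

  Cay : Graph
  Cay = record
    { vertices = setoid
    ; _~_      = λ g h → (g ⁻¹ ∙ h) ∈ X
    ; ~-resp-≈ = (λ e → X-resp-≈ (∙-congˡ e)) , (λ e → X-resp-≈ (∙-congʳ (⁻¹-cong e)))
    ; ~-sym    = λ {g} {h} p → X-resp-≈
        (≈-trans (⁻¹-anti-homo-∙ (g ⁻¹) h) (∙-congˡ (⁻¹-involutive g)))
        (inverse-closed p)
    ; ~-irrefl = λ {g} {h} e p → unit-free
        (X-resp-≈ (≈-trans (∙-congˡ (≈-sym e)) (inverseˡ g)) p)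
    }

  CayDegree : ℕ → Set
  CayDegree = HasSize elements

CayleyOrder : ℕ → Pred ℕ (Level.suc 0ℓ)
CayleyOrder d n = Σ[ Γ ∈ Group 0ℓ 0ℓ ] Σ[ S ∈ ConnectionSet Γ ]
  CayDegree Γ S d × HasOrder (Cay Γ S) n × HasDiameter (Cay Γ S) 2

-- Total convention: the maximum of the empty set is 0.
IsMaximum : ∀ {ℓ} → Pred ℕ ℓ → ℕ → Set ℓ
IsMaximum P m = (∀ n → P n → n ≤ m) × (∃ P → P m) × ((∀ n → ¬ P n) → m ≡ 0)

-- Well-definedness of C⟨ d ,2⟩: orders are at most (1 + d)²,
-- and CayleyOrder d n is decided by a search through the multiplication
-- tables on Fin n and the d-tuples of connection set elements.

private
  module _ (G : Graph) where
    open Graph G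
    open Setoid vertices using () renaming (refl to ≈-refl; sym to ≈-sym)

    Short : Set
    Short = (∀ u v → u ≈ v ⊎ u ~ v ⊎ ∃ λ w → u ~ w × w ~ v)
          × (∃₂ λ u v → ¬ u ≈ v × ¬ u ~ v)

    unwalk : ∀ {k u v} → k ≤ 2 → Walk G k u v → u ≈ v ⊎ u ~ v ⊎ ∃ λ w → u ~ w × w ~ v
    unwalk _ (nil e) = inj₁ e
    unwalk _ (cons p (nil e)) = inj₂ (inj₁ (proj₁ ~-resp-≈ e p))
    unwalk _ (cons p (cons q (nil e))) = inj₂ (inj₂ (_ , p , proj₁ ~-resp-≈ e q))
    unwalk (s≤s (s≤s ())) (cons _ (cons _ (cons _ _)))

    diameter⇒short : HasDiameter G 2 → Short
    diameter⇒short (f , u , v , _ , min) =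
      (λ a b → let _ , (w , _) , k≤2 = f a b in unwalk k≤2 w) ,
      u , v ,
      (λ e → contradiction (min (nil e)) λ ()) ,
      (λ p → contradiction (min (cons p (nil ≈-refl))) λ { (s≤s ()) })

    module _ (_≈?_ : Decidable₂ _≈_) (_~?_ : Decidable₂ _~_) where

      ≉⇒1≤ : ∀ {j u v} → ¬ u ≈ v → Walk G j u v → 1 ≤ j
      ≉⇒1≤ u≉v (nil e)    = contradiction e u≉v
      ≉⇒1≤ u≉v (cons _ _) = s≤s z≤n

      ≁⇒2≤ : ∀ {j u v} → ¬ u ≈ v → ¬ u ~ v → Walk G j u v → 2 ≤ j
      ≁⇒2≤ u≉v u≁v (nil e)             = contradiction e u≉v
      ≁⇒2≤ u≉v u≁v (cons p (nil e))    = contradiction (proj₁ ~-resp-≈ e p) u≁v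
      ≁⇒2≤ u≉v u≁v (cons _ (cons _ _)) = s≤s (s≤s z≤n)

      short⇒diameter : Short → HasDiameter G 2
      short⇒diameter (f , u , v , u≉v , u≁v) = dist , u , v , far u≉v u≁v
        where
        far : ∀ {a b} → ¬ a ≈ b → ¬ a ~ b → Distance G a b 2
        far {a} {b} a≉b a≁b with f a b
        ... | inj₁ e                  = contradiction e a≉b
        ... | inj₂ (inj₁ p)           = contradiction p a≁b
        ... | inj₂ (inj₂ (_ , p , q)) = cons p (cons q (nil ≈-refl)) , ≁⇒2≤ a≉b a≁b

        dist : ∀ a b → ∃ λ k → Distance G a b k × k ≤ 2
        dist a b with a ≈? b
        ... | yes e = 0 , (nil e , λ _ → z≤n) , z≤n
        ... | no a≉b with a ~? b
        ...   | yes p  = 1 , (cons p (nil ≈-refl) , ≉⇒1≤ a≉b) , s≤s z≤n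
        ...   | no a≁b = 2 , far a≉b a≁b , ≤-refl

  record Table (d n : ℕ) (_·_ : Fin n → Fin n → Fin n) (g : Fin d → Fin n) (e : Fin n) : Set where
    constructor table
    field
      assoc     : ∀ a b c → ((a · b) · c) ≡ (a · (b · c))
      identityˡ : ∀ a → (e · a) ≡ a
      identityʳ : ∀ a → (a · e) ≡ a
      inverses  : ∀ a → ∃ λ b → (b · a) ≡ e × (a · b) ≡ e
      injective : ∀ i j → g i ≡ g j → i ≡ j
      unit-free : ∀ i → g i ≢ e
      closed    : ∀ i → ∃ λ j → (g i · g j) ≡ e
      short     : ∀ a b → a ≡ b ⊎ (∃ λ i → (a · g i) ≡ b)
                        ⊎ (∃₂ λ i j → ((a · g i) · g j) ≡ b)
      far       : ∃₂ λ a b → a ≢ b × (∀ i → (a · g i) ≢ b)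

  table? : ∀ d n _·_ g e → Dec (Table d n _·_ g e)
  table? d n _·_ g e = map′
    (λ (a , b , c , d , e , f , g , h , i) → table a b c d e f g h i)
    (λ (table a b c d e f g h i) → a , b , c , d , e , f , g , h , i)
    (  all? (λ a → all? λ b → all? λ c → ((a · b) · c) Fin.≟ (a · (b · c)))
    ×-dec all? (λ a → (e · a) Fin.≟ a)
    ×-dec all? (λ a → (a · e) Fin.≟ a)
    ×-dec all? (λ a → any? λ b → ((b · a) Fin.≟ e) ×-dec ((a · b) Fin.≟ e))
    ×-dec all? (λ i → all? λ j → (g i Fin.≟ g j) →-dec (i Fin.≟ j))
    ×-dec all? (λ i → ¬? (g i Fin.≟ e))
    ×-dec all? (λ i → any? λ j → (g i · g j) Fin.≟ e)
    ×-dec all? (λ a → all? λ b → (a Fin.≟ b) ⊎-dec (any? (λ i → (a · g i) Fin.≟ b)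
            ⊎-dec any? (λ i → any? λ j → ((a · g i) · g j) Fin.≟ b)))
    ×-dec any? (λ a → any? λ b → ¬? (a Fin.≟ b) ×-dec all? (λ i → ¬? ((a · g i) Fin.≟ b))))

  Searchable : Set → Set₁
  Searchable A = {P : Pred A 0ℓ} → Decidable P → Dec (∃ P)

  searchVec : ∀ {A} → Searchable A → ∀ n → Searchable (Vec A n)
  searchVec s zero    P? = map′ ([] ,_) (λ { ([] , p) → p }) (P? [])
  searchVec s (suc n) P? = map′
    (λ (x , xs , p) → (x ∷ xs) , p)
    (λ { ((x ∷ xs) , p) → x , xs , p })
    (s λ x → searchVec s n λ xs → P? (x ∷ xs))

  SomeTable : ℕ → ℕ → Set
  SomeTable d n = ∃ λ (t : Vec (Vec (Fin n) n) n) → ∃ λ (v : Vec (Fin n) d) →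
    ∃ λ e → Table d n (λ a b → lookup (lookup t a) b) (lookup v) e

  someTable? : ∀ d n → Dec (SomeTable d n)
  someTable? d n =
    searchVec (searchVec any? n) n λ t → searchVec any? d λ v → any? λ e → table? d n _ _ e

  module FromTable {d n : ℕ} {_·_ : Fin n → Fin n → Fin n} {g : Fin d → Fin n} {e : Fin n}
                   (T : Table d n _·_ g e) where
    open Table T
    open ≡.≡-Reasoning

    _⁻ : Fin n → Fin n
    a ⁻ = proj₁ (inverses a)

    group : Group 0ℓ 0ℓ
    group = record
      { Carrier = Fin n ; _≈_ = _≡_ ; _∙_ = _·_ ; ε = e ; _⁻¹ = _⁻
      ; isGroup = record
        { isMonoid = record
          { isSemigroup = record
            { isMagma = record
              { isEquivalence = ≡.isEquivalence
              ; ∙-cong = cong₂ _·_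
              }
            ; assoc = assoc
            }
          ; identity = identityˡ , identityʳ
          }
        ; inverse = (λ a → proj₁ (proj₂ (inverses a))) , (λ a → proj₂ (proj₂ (inverses a)))
        ; ⁻¹-cong = cong _⁻
        }
      }

    open Group group using (inverseˡ; inverseʳ; _\\_)
    open GroupProperties group using (inverseʳ-unique; \\-leftDividesˡ; \\-leftDividesʳ)

    X : Pred (Fin n) 0ℓ
    X a = ∃ λ i → g i ≡ a

    step : ∀ a {b i} → (a · g i) ≡ b → X (a \\ b)
    step a refl = _ , ≡.sym (\\-leftDividesʳ a _)

    unstep : ∀ a {b} → ((i , _) : X (a \\ b)) → (a · g i) ≡ b
    unstep a {b} (i , p) = ≡.trans (cong (a ·_) p) (\\-leftDividesˡ a b)

    generated : ∀ a → ⟨_⟩ group X a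
    generated a with short e a
    ... | inj₁ refl                   = unit
    ... | inj₂ (inj₁ (i , refl))      = mul unit (gen (i , refl))
    ... | inj₂ (inj₂ (i , j , refl))  = mul (mul unit (gen (i , refl))) (gen (j , refl))

    connectionSet : ConnectionSet group
    connectionSet = record
      { X              = X
      ; X-resp-≈       = λ { refl p → p }
      ; generating     = generated
      ; unit-free      = λ (i , p) → unit-free i p
      ; inverse-closed = λ { (i , refl) → let j , p = closed i in
                             j , inverseʳ-unique (g i) (g j) p }
      }

    cayleyOrder : CayleyOrder d n
    cayleyOrder = group , connectionSet ,
      record
        { to        = λ (_ , i , _) → i
        ; from      = λ i → g i , i , refl
        ; to-cong   = λ { {_ , i , p} {_ , j , q} r → injective i j (≡.trans p (≡.trans r (≡.sym q))) }
        ; from-cong = cong g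
        ; inverse   = (λ { {i} {_ , j , q} r → injective j i (≡.trans q r) })
                    , (λ { {_ , i , p} r → ≡.trans (cong g r) p })
        } ,
      record
        { to = λ a → a ; from = λ a → a ; to-cong = λ p → p ; from-cong = λ p → p
        ; inverse = (λ p → p) , (λ p → p)
        } ,
      short⇒diameter (Cay group connectionSet) Fin._≟_
        (λ a b → any? λ i → g i Fin.≟ (a \\ b))
        (conv , far′)
      where
      conv : ∀ a b → a ≡ b ⊎ X (a \\ b) ⊎ ∃ λ c → X (a \\ c) × X (c \\ b)
      conv a b with short a b
      ... | inj₁ p                  = inj₁ p
      ... | inj₂ (inj₁ (i , p))     = inj₂ (inj₁ (step a p))
      ... | inj₂ (inj₂ (i , j , p)) = inj₂ (inj₂ (_ , step a refl , step (a · g i) p))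

      far′ : ∃₂ λ a b → a ≢ b × ¬ X (a \\ b)
      far′ = let a , b , a≢b , h = far in
        a , b , a≢b , λ x → h (proj₁ x) (unstep a x)

    z : Fin (suc d)
    z = zero

    p : Fin (suc d) → Fin n
    p zero    = e
    p (suc i) = g i

    decode : Fin (suc d * suc d) → Fin n
    decode k = let i , j = remQuot {suc d} (suc d) k in p i · p j

    decode-combine : ∀ i j → decode (combine i j) ≡ (p i · p j)
    decode-combine i j = cong (λ (i , j) → p i · p j) (Fin.remQuot-combine i j)

    encode : ∀ a → ∃ λ k → decode k ≡ a
    encode a with short e a
    ... | inj₁ q = combine z z , ≡.trans (decode-combine z z) (≡.trans (identityˡ e) q)
    ... | inj₂ (inj₁ (i , q)) = combine z (suc i) , ≡.trans (decode-combine z (suc i)) q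
    ... | inj₂ (inj₂ (i , j , q)) = combine (suc i) (suc j) , (begin
      decode (combine (suc i) (suc j)) ≡⟨ decode-combine (suc i) (suc j) ⟩
      (g i · g j)                      ≡⟨ cong (_· g j) (identityˡ (g i)) ⟨
      ((e · g i) · g j)                ≡⟨ q ⟩
      a                                ∎)

    bound : n ≤ suc d * suc d
    bound = Fin.injective⇒≤ {f = proj₁ ∘ encode} λ {a} {b} q →
      ≡.trans (≡.sym (proj₂ (encode a))) (≡.trans (cong decode q) (proj₂ (encode b)))

  module ToTable {d n : ℕ} (Γ : Group 0ℓ 0ℓ) (S : ConnectionSet Γ) (deg : CayDegree Γ S d)
                 (ord : HasOrder (Cay Γ S) n) (diam : HasDiameter (Cay Γ S) 2) where
    open Group Γ renaming (refl to ≈-refl; sym to ≈-sym; trans to ≈-trans)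
    open GroupProperties Γ
    open ConnectionSet S
    private
      module D = Inverse deg
      module O = Inverse ord

    x : Fin d → Carrier
    x i = proj₁ (D.from i)

    module _ (_·_ : Fin n → Fin n → Fin n) (·-spec : ∀ a b → (a · b) ≡ O.to (O.from a ∙ O.from b))
             (g : Fin d → Fin n) (g-spec : ∀ i → g i ≡ O.to (x i)) where

      from-to : ∀ u → O.from (O.to u) ≈ u
      from-to u = O.inverseʳ refl

      from-inj : ∀ {a b} → O.from a ≈ O.from b → a ≡ b
      from-inj {a} {b} r = ≡.trans (≡.sym (O.inverseˡ ≈-refl)) (O.inverseˡ r)

      from-· : ∀ a b → O.from (a · b) ≈ O.from a ∙ O.from b
      from-· a b = ≈-trans (O.from-cong (·-spec a b)) (from-to _)

      from-g : ∀ i → O.from (g i) ≈ x i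
      from-g i = ≈-trans (O.from-cong (g-spec i)) (from-to _)

      index : ∀ {u} → u ∈ X → ∃ λ i → x i ≈ u
      index {u} p = D.to (u , p) , D.inverseʳ refl

      index-~ : ∀ {u v} → (u \\ v) ∈ X → ∃ λ i → u ∙ x i ≈ v
      index-~ {u} {v} p = let i , q = index p in
        i , ≈-trans (∙-congˡ q) (\\-leftDividesˡ u v)

      from-·g : ∀ a i → O.from (a · g i) ≈ O.from a ∙ x i
      from-·g a i = ≈-trans (from-· a (g i)) (∙-congˡ (from-g i))

      from-e : O.from (O.to ε) ≈ ε
      from-e = from-to ε

      open SetoidReasoning setoid

      tab : Table d n _·_ g (O.to ε)
      tab = record
        { assoc = λ a b c → from-inj (begin
            O.from ((a · b) · c)             ≈⟨ from-· (a · b) c ⟩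
            O.from (a · b) ∙ O.from c        ≈⟨ ∙-congʳ (from-· a b) ⟩
            (O.from a ∙ O.from b) ∙ O.from c ≈⟨ assoc _ _ _ ⟩
            O.from a ∙ (O.from b ∙ O.from c) ≈⟨ ∙-congˡ (from-· b c) ⟨
            O.from a ∙ O.from (b · c)        ≈⟨ from-· a (b · c) ⟨
            O.from (a · (b · c))             ∎)
        ; identityˡ = λ a → from-inj
            (≈-trans (from-· _ a) (≈-trans (∙-congʳ from-e) (identityˡ _)))
        ; identityʳ = λ a → from-inj
            (≈-trans (from-· a _) (≈-trans (∙-congˡ from-e) (identityʳ _)))
        ; inverses = λ a → O.to (O.from a ⁻¹) ,
            from-inj (≈-trans (from-· _ a) (≈-trans (∙-congʳ (from-to _))
              (≈-trans (inverseˡ _) (≈-sym from-e)))) ,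
            from-inj (≈-trans (from-· a _) (≈-trans (∙-congˡ (from-to _))
              (≈-trans (inverseʳ _) (≈-sym from-e))))
        ; injective = λ i j r →
            let q : x i ≈ x j
                q = ≈-trans (≈-sym (from-g i)) (≈-trans (O.from-cong r) (from-g j))
            in ≡.trans (≡.sym (D.inverseˡ {i} {D.from i} ≈-refl)) (D.inverseˡ q)
        ; unit-free = λ i r → unit-free (X-resp-≈
            (≈-trans (≈-sym (from-g i)) (≈-trans (O.from-cong r) from-e))
            (proj₂ (D.from i)))
        ; closed = λ i → let j , q = index (inverse-closed (proj₂ (D.from i))) in
            j , from-inj (≈-trans (from-·g (g i) j) (≈-trans (∙-cong (from-g i) q)
              (≈-trans (inverseʳ _) (≈-sym from-e))))
        ; short = short′
        ; far = far′
        }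
        where
        sh = diameter⇒short (Cay Γ S) diam

        short′ : ∀ a b → a ≡ b ⊎ (∃ λ i → (a · g i) ≡ b)
                        ⊎ (∃₂ λ i j → ((a · g i) · g j) ≡ b)
        short′ a b with proj₁ sh (O.from a) (O.from b)
        ... | inj₁ r = inj₁ (from-inj r)
        ... | inj₂ (inj₁ r) = let i , q = index-~ r in
          inj₂ (inj₁ (i , from-inj (≈-trans (from-·g a i) q)))
        ... | inj₂ (inj₂ (w , r , s)) =
          let i , q = index-~ r
              j , t = index-~ s
          in inj₂ (inj₂ (i , j , from-inj (≈-trans (from-·g _ j)
               (≈-trans (∙-congʳ (≈-trans (from-·g a i) q)) t))))

        far′ : ∃₂ λ a b → a ≢ b × (∀ i → (a · g i) ≢ b)
        far′ = let u , v , u≉v , u≁v = proj₂ sh in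
          O.to u , O.to v ,
          (λ r → u≉v (≈-trans (≈-sym (from-to u)) (≈-trans (O.from-cong r) (from-to v)))) ,
          (λ i r → u≁v (X-resp-≈
            (begin
              x i                    ≈⟨ \\-leftDividesʳ u (x i) ⟨
              u ⁻¹ ∙ (u ∙ x i)       ≈⟨ ∙-congˡ (∙-congʳ (from-to u)) ⟨
              u ⁻¹ ∙ (O.from (O.to u) ∙ x i) ≈⟨ ∙-congˡ (from-·g (O.to u) i) ⟨
              u ⁻¹ ∙ O.from (O.to u · g i)   ≈⟨ ∙-congˡ (O.from-cong r) ⟩
              u ⁻¹ ∙ O.from (O.to v)         ≈⟨ ∙-congˡ (from-to v) ⟩
              u ⁻¹ ∙ v               ∎)
            (proj₂ (D.from i))))

    someTable : SomeTable d n
    someTable =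
      tabulate (λ a → tabulate λ b → O.to (O.from a ∙ O.from b)) ,
      tabulate (O.to ∘ x) , O.to ε ,
      tab _ (λ a b → ≡.trans (cong (λ r → lookup r b) (lookup∘tabulate _ a)) (lookup∘tabulate _ b))
          _ (lookup∘tabulate _)

  cayleyOrder? : ∀ d → Decidable (CayleyOrder d)
  cayleyOrder? d n = map′
    (λ (_ , _ , _ , T) → FromTable.cayleyOrder T)
    (λ (Γ , S , deg , ord , diam) → ToTable.someTable Γ S deg ord diam)
    (someTable? d n)

  cayleyOrder-bound : ∀ d n → CayleyOrder d n → n ≤ suc d * suc d
  cayleyOrder-bound d n (Γ , S , deg , ord , diam) =
    let _ , _ , _ , T = ToTable.someTable Γ S deg ord diam in FromTable.bound T

  maximum : ∀ {ℓ} {P : Pred ℕ ℓ} → Decidable P →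
            ∀ b → (∀ n → P n → n ≤ b) → ∃ (IsMaximum P)
  maximum {P = P} P? zero h = 0 , h , (λ (n , p) → subst P (ℕ.n≤0⇒n≡0 (h n p)) p) , λ _ → refl
  maximum {P = P} P? (suc b) h with P? (suc b)
  ... | yes p = suc b , h , (λ _ → p) , λ none → contradiction p (none (suc b))
  ... | no ¬p = maximum P? b λ n p → lower n p (m≤n⇒m<n∨m≡n (h n p))
    where
    lower : ∀ n → P n → suc n ≤ suc b ⊎ n ≡ suc b → n ≤ b
    lower n p (inj₁ (s≤s q)) = q
    lower n p (inj₂ refl)    = contradiction p ¬p

-- Opaque: unfolding would run the exhaustive search.
opaque
  C⟨_,2⟩ : ℕ → ℕ
  C⟨ d ,2⟩ = proj₁ (maximum (cayleyOrder? d) (suc d * suc d) (cayleyOrder-bound d))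

  C-isMaximum : ∀ d → IsMaximum (CayleyOrder d) C⟨ d ,2⟩
  C-isMaximum d = proj₂ (maximum (cayleyOrder? d) (suc d * suc d) (cayleyOrder-bound d))

{-# OPTIONS --safe #-}

-- Every bound is attained in the wreath product ℤ_n ≀ ℤ_2, of order 2n², for n = 10, 12, …, 28.
-- A Cayley graph with connection set X ∪ {1} ≠ Γ has diameter two as soon as (X ∪ {1})² = Γ,
-- which is a finite computation once X is written down.  The sets X below were found by
-- simulated annealing; except for n = 20, their elements (a , b) in the base group all
-- satisfy a + b ≡ n / 2.

module Submission where

open import Algebra.Bundles using (Group)
open import Algebra.Construct.DirectProduct using () renaming (group to _×ᵍ_)
import Algebra.Properties.Group as GroupProperties
open import Data.Bool using (Bool; true; false; _xor_)
import Data.Bool.Properties as Bool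
open import Data.Fin using (Fin; zero; suc; toℕ)
import Data.Fin.Properties as Fin
open import Data.List using
  (List; []; _∷_; length; lookup; map; _++_; filter; cartesianProductWith)
import Data.List.Membership.DecSetoid as DecMembership
open import Data.List.Membership.Setoid.Properties
  using (∈-resp-≈; ∈-lookup; All[≉]⇒∉; ∈-cartesianProductWith⁻)
open import Data.List.Relation.Unary.All as All using (All; all?; _∷_)
open import Data.List.Relation.Unary.AllPairs using (_∷_)
open import Data.List.Relation.Unary.Any as Any using (here; there)
open import Data.List.Relation.Unary.Any.Properties using (lookup-index; filter⁻)
import Data.List.Relation.Unary.Unique.DecSetoid as DecUnique
open import Data.Nat using (ℕ; suc; NonZero; pred; _+_; _*_; _%_; _≤_; _≥_; z≤n; s≤s)
open import Data.Nat.DivMod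
  using (_mod_; %-distribˡ-+; %-distribˡ-*; m%n%n≡m%n; m%n<n; m<n⇒m%n≡m; m*n%n≡0)
import Data.Nat.Properties as ℕ
open import Data.Product using (∃; ∃₂; _×_; _,_; proj₁; proj₂)
open import Data.Product.Function.NonDependent.Setoid using (_×-inverse_)
open import Data.Product.Relation.Binary.Pointwise.NonDependent
  using (_×ₛ_; ×-decidable; Pointwise-≡↔≡)
open import Function.Bundles using (Inverse)
import Function.Construct.Composition as Compose
import Function.Construct.Symmetry as Symmetry
open import Level using (0ℓ)
open import Relation.Binary.Bundles using (Setoid; DecSetoid)
import Relation.Binary.Construct.On as On
open import Relation.Binary.Definitions using (Decidable)
open import Relation.Binary.PropositionalEquality as ≡ using (_≡_; refl; cong; cong₂)
import Relation.Binary.Reasoning.Setoid as SetoidReasoning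
open import Relation.Nullary using (Dec; yes; no; contradiction)
open import Relation.Nullary.Decidable using (True; toWitness; _×-dec_)

open import Defs

-- Only the upper-bound half of maximality enters, so one graph of the right degree and diameter
-- suffices and the opaque search is never evaluated.
order≤C : ∀ {d n} → CayleyOrder d n → C⟨ d ,2⟩ ≥ n
order≤C {d} {n} = proj₁ (C-isMaximum d) n

-- Cayley graphs of diameter two from a finite list of generators

module Connection (Γ : Group 0ℓ 0ℓ) (_≟_ : Decidable (Group._≈_ Γ))
                  (xs : List (Group.Carrier Γ)) where
  open Group Γ renaming (refl to ≈-refl; sym to ≈-sym; trans to ≈-trans)
  open GroupProperties Γ using (\\-leftDividesˡ; \\-leftDividesʳ; ⁻¹-anti-homo-∙)

  decSetoid : DecSetoid 0ℓ 0ℓ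
  decSetoid = record { isDecEquivalence = record { isEquivalence = isEquivalence ; _≟_ = _≟_ } }

  open DecMembership decSetoid using (_∈_; _∉_; _∈?_)
  open DecUnique decSetoid using (Unique)

  products : List Carrier
  products = cartesianProductWith _∙_ (ε ∷ xs) (ε ∷ xs)

  -- Putting `ε` in front of `xs` serves every field: uniqueness says both that the generators are
  -- distinct and that none is the identity, an element outside `ε ∷ xs` excludes diameter below
  -- two, and products of two entries are exactly the words of length at most two.
  record Spans : Set where
    field
      unique         : Unique (ε ∷ xs)
      inverse-closed : All (λ x → x ⁻¹ ∈ xs) xs
      missed         : ∃ λ v → v ∉ ε ∷ xs
      reached        : ∀ v → v ∈ products

  lookup-injective : ∀ {ys} → Unique ys → ∀ i j → lookup ys i ≈ lookup ys j → i ≡ j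
  lookup-injective (_ ∷ _)  zero    zero    _ = refl
  lookup-injective {_ ∷ ys} (∉ys ∷ _) zero (suc j) e =
    contradiction (∈-resp-≈ setoid (≈-sym e) (∈-lookup setoid ys j)) (All[≉]⇒∉ setoid ∉ys)
  lookup-injective {_ ∷ ys} (∉ys ∷ _) (suc i) zero e =
    contradiction (∈-resp-≈ setoid e (∈-lookup setoid ys i)) (All[≉]⇒∉ setoid ∉ys)
  lookup-injective (_ ∷ u)  (suc i) (suc j) e = cong suc (lookup-injective u i j e)

  -- The degree counts elements up to `_≈_`, whatever their membership proofs; without repetitions
  -- in the list, the position depends on the element alone.
  index-cong : ∀ {u v ys} → Unique ys → (p : u ∈ ys) (q : v ∈ ys) →
               u ≈ v → Any.index p ≡ Any.index q
  index-cong unique p q e = lookup-injective unique (Any.index p) (Any.index q)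
    (≈-trans (≈-sym (lookup-index p)) (≈-trans e (lookup-index q)))

  module _ (spans : Spans) where
    open Spans spans

    ε∉xs : ε ∉ xs
    ε∉xs with ε≉ ∷ _ ← unique = All[≉]⇒∉ setoid ε≉

    unique-xs : Unique xs
    unique-xs with _ ∷ u ← unique = u

    Generated : Carrier → Set
    Generated = ⟨_⟩ Γ (_∈ xs)

    factors : ∀ v → ∃₂ λ x y → x ∈ ε ∷ xs × y ∈ ε ∷ xs × v ≈ x ∙ y
    factors v =
      ∈-cartesianProductWith⁻ setoid setoid setoid _∙_ (ε ∷ xs) (ε ∷ xs) (reached v)

    generated : ∀ v → Generated v
    generated v with x , y , p , q , e ← factors v =
      resp (≈-sym e) (mul (short p) (short q))
      where
      short : ∀ {x} → x ∈ ε ∷ xs → Generated x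
      short (here x≈ε) = resp (≈-sym x≈ε) unit
      short (there p)  = gen p

    connectionSet : ConnectionSet Γ
    connectionSet = record
      { X              = _∈ xs
      ; X-resp-≈       = ∈-resp-≈ setoid
      ; generating     = generated
      ; unit-free      = ε∉xs
      -- The condition is checked on the listed entries and carried to every equal element, because
      -- inversion respects `_≈_`.
      ; inverse-closed = All.lookupₛ setoid (λ e → ∈-resp-≈ setoid (⁻¹-cong e)) inverse-closed
      }

    degree : CayDegree Γ connectionSet (length xs)
    degree = record
      { to        = λ (_ , p) → Any.index p
      ; from      = λ i → lookup xs i , ∈-lookup setoid xs i
      ; to-cong   = λ {(_ , p)} {(_ , q)} → index-cong unique-xs p q
      ; from-cong = λ { refl → ≈-refl }
      ; inverse   =
          (λ {i} {(_ , p)} e → lookup-injective unique-xs (Any.index p) i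
            (≈-trans (≈-sym (lookup-index p)) e)) ,
          (λ { {_ , p} refl → ≈-sym (lookup-index p) })
      }

    private
      G : Graph
      G = Cay Γ connectionSet

    ε\\ : ∀ v → ε \\ v ≈ v
    ε\\ v = ≈-trans (≈-sym (identityˡ _)) (\\-leftDividesˡ ε v)

    -- A walk of length 0 would make the quotient of the end points equal to `ε`, and one of length
    -- 1 would make it a generator.
    far⇒distance₂ : ∀ {u v} → (u \\ v) ∉ ε ∷ xs → Walk G 2 u v → Distance G u v 2
    far⇒distance₂ {u} {v} far w = w , minimal
      where
      minimal : ∀ {j} → Walk G j u v → 2 ≤ j
      minimal (nil e) =
        contradiction (here (≈-trans (∙-congˡ (≈-sym e)) (inverseˡ u))) far
      minimal (cons p (nil e)) = contradiction (there (∈-resp-≈ setoid (∙-congˡ e) p)) far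
      minimal (cons _ (cons _ _)) = s≤s (s≤s z≤n)

    -- If one factor were `ε`, then `v` would equal the other factor and lie in `ε ∷ xs`.
    proper-factors : ∀ {v} → v ∉ ε ∷ xs → ∃₂ λ x y → x ∈ xs × y ∈ xs × v ≈ x ∙ y
    proper-factors {v} v∉ with factors v
    ... | x , y , there p , there q , e = x , y , p , q , e
    ... | x , y , here x≈ε , q , e = contradiction
      (∈-resp-≈ setoid (≈-sym (≈-trans e (≈-trans (∙-congʳ x≈ε) (identityˡ y)))) q) v∉
    ... | x , y , p , here y≈ε , e = contradiction
      (∈-resp-≈ setoid (≈-sym (≈-trans e (≈-trans (∙-congˡ y≈ε) (identityʳ x)))) p) v∉

    walk₂ : ∀ {u v} → (u \\ v) ∉ ε ∷ xs → Walk G 2 u v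
    walk₂ {u} {v} far with x , y , p , q , u\\v≈xy ← proper-factors far =
      -- Left translation by `u` turns the word `x ∙ y` into a walk from `u` to `v` through `u ∙ x`.
      cons {v = u ∙ x} (∈-resp-≈ setoid (≈-sym (\\-leftDividesʳ u x)) p)
        (cons {v = v} (∈-resp-≈ setoid (≈-sym ux\\v≈y) q) (nil ≈-refl))
      where
      open SetoidReasoning setoid
      ux\\v≈y : (u ∙ x) \\ v ≈ y
      ux\\v≈y = begin
        (u ∙ x) ⁻¹ ∙ v      ≈⟨ ∙-congʳ (⁻¹-anti-homo-∙ u x) ⟩
        (x ⁻¹ ∙ u ⁻¹) ∙ v   ≈⟨ assoc _ _ _ ⟩
        x \\ (u \\ v)       ≈⟨ ∙-congˡ u\\v≈xy ⟩
        x \\ (x ∙ y)        ≈⟨ \\-leftDividesʳ x y ⟩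
        y                   ∎

    diameter : HasDiameter G 2
    diameter = distances , ε , v , far⇒distance₂ far (walk₂ far)
      where
      v = proj₁ missed

      far : (ε \\ v) ∉ ε ∷ xs
      far p = proj₂ missed (∈-resp-≈ setoid (ε\\ v) p)

      distances : ∀ u v → ∃ λ k → Distance G u v k × k ≤ 2
      -- The head of the list, its tail and its complement correspond to distances 0, 1 and 2.
      distances u v with (u \\ v) ∈? (ε ∷ xs)
      ... | no far′ = 2 , far⇒distance₂ far′ (walk₂ far′) , ℕ.≤-refl
      ... | yes (here e) = 0 , (nil u≈v , λ _ → z≤n) , z≤n
        where
        u≈v : u ≈ v
        u≈v = ≈-trans (≈-sym (identityʳ u))
          (≈-trans (∙-congˡ (≈-sym e)) (\\-leftDividesˡ u v))
      ... | yes (there p) = 1 , (cons p (nil ≈-refl) , minimal) , s≤s z≤n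
        where
        minimal : ∀ {j} → Walk G j u v → 1 ≤ j
        minimal (nil e)    =
          contradiction (∈-resp-≈ setoid (≈-trans (∙-congˡ (≈-sym e)) (inverseˡ u)) p) ε∉xs
        minimal (cons _ _) = s≤s z≤n

    cayleyOrder : ∀ {n} → HasSize setoid n → CayleyOrder (length xs) n
    cayleyOrder size = Γ , connectionSet , degree , size , diameter

-- The cyclic group of order n

module Cyclic (n : ℕ) .{{_ : NonZero n}} where

  infix 4 _≈_ _≈?_

  -- Taking residues as a setoid on `ℕ` lets the group laws descend from those of `ℕ`, and
  -- generators can be written as plain numerals.
  _≈_ : ℕ → ℕ → Set
  a ≈ b = a % n ≡ b % n

  _≈?_ : Decidable _≈_
  a ≈? b = a % n ℕ.≟ b % n

  +-cong : ∀ {a b c d} → a ≈ b → c ≈ d → a + c ≈ b + d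
  +-cong {a} {b} {c} {d} p q = begin
    (a + c) % n         ≡⟨ %-distribˡ-+ a c n ⟩
    (a % n + c % n) % n ≡⟨ cong₂ (λ x y → (x + y) % n) p q ⟩
    (b % n + d % n) % n ≡⟨ %-distribˡ-+ b d n ⟨
    (b + d) % n         ∎
    where open ≡.≡-Reasoning

  -- Since n - 1 represents -1, multiplying by it negates without truncated subtraction: a + a(n -
  -- 1) = an ≡ 0.
  neg : ℕ → ℕ
  neg a = a * pred n

  neg-cong : ∀ {a b} → a ≈ b → neg a ≈ neg b
  neg-cong {a} {b} p = begin
    (a * pred n) % n             ≡⟨ %-distribˡ-* a (pred n) n ⟩
    (a % n * (pred n % n)) % n   ≡⟨ cong (λ x → (x * (pred n % n)) % n) p ⟩
    (b % n * (pred n % n)) % n   ≡⟨ %-distribˡ-* b (pred n) n ⟨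
    (b * pred n) % n             ∎
    where open ≡.≡-Reasoning

  +-inverseʳ : ∀ a → a + neg a ≈ 0
  +-inverseʳ a = begin
    (a + a * pred n) % n   ≡⟨ cong (_% n) (ℕ.*-suc a (pred n)) ⟨
    (a * suc (pred n)) % n ≡⟨ cong (λ m → (a * m) % n) (ℕ.suc-pred n) ⟩
    (a * n) % n            ≡⟨ m*n%n≡0 a n ⟩
    0                      ≡⟨ m*n%n≡0 0 n ⟨
    0 % n                  ∎
    where open ≡.≡-Reasoning

  group : Group 0ℓ 0ℓ
  group = record
    { Carrier = ℕ ; _≈_ = _≈_ ; _∙_ = _+_ ; ε = 0 ; _⁻¹ = neg
    ; isGroup = record
      { isMonoid = record
        { isSemigroup = record
          { isMagma = record
            { isEquivalence = On.isEquivalence (_% n) ≡.isEquivalence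
            ; ∙-cong = λ {a} {b} {c} {d} → +-cong {a} {b} {c} {d}
            }
          ; assoc = λ a b c → cong (_% n) (ℕ.+-assoc a b c)
          }
        ; identity = (λ _ → refl) , (λ a → cong (_% n) (ℕ.+-identityʳ a))
        }
      ; inverse = (λ a → ≡.trans (cong (_% n) (ℕ.+-comm (neg a) a)) (+-inverseʳ a)) , +-inverseʳ
      ; ⁻¹-cong = λ {a} {b} → neg-cong {a} {b}
      }
    }

  toℕ-mod : ∀ a → toℕ (a mod n) ≡ a % n
  toℕ-mod a = Fin.toℕ-fromℕ< (m%n<n a n)

  size : HasSize (Group.setoid group) n
  size = record
    { to        = _mod n
    ; from      = toℕ
    ; to-cong   = λ {a} {b} e → Fin.toℕ-injective
        (≡.trans (toℕ-mod a) (≡.trans e (≡.sym (toℕ-mod b))))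
    ; from-cong = cong (λ i → toℕ i % n)
    ; inverse   =
        (λ {i} {a} e → Fin.toℕ-injective (≡.trans (toℕ-mod a)
          (≡.trans e (m<n⇒m%n≡m (Fin.toℕ<n i))))) ,
        (λ { {a} refl → ≡.trans (cong (_% n) (toℕ-mod a)) (m%n%n≡m%n a n) })
    }

-- The wreath product of A with the group of order two.
module Wreath (A : Group 0ℓ 0ℓ) where

  private
    module A  = Group A
    module A² = Group (A ×ᵍ A)

  swapIf : Bool → A².Carrier → A².Carrier
  swapIf false u       = u
  swapIf true  (a , b) = b , a

  swapIf-cong : ∀ e {u v} → u A².≈ v → swapIf e u A².≈ swapIf e v
  swapIf-cong false p       = p
  swapIf-cong true  (p , q) = q , p

  group : Group 0ℓ 0ℓ
  group = record
    { Carrier = A².Carrier × Bool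
    ; _≈_     = Setoid._≈_ (A².setoid ×ₛ ≡.setoid Bool)
    ; _∙_     = λ (u , e) (v , f) → u A².∙ swapIf e v , e xor f
    ; ε       = A².ε , false
    -- Swapping is an involution and `e xor e` is `false`, so solving for the right inverse of
    -- `(u , e)` gives this pair.
    ; _⁻¹     = λ (u , e) → swapIf e (u A².⁻¹) , e
    ; isGroup = record
      { isMonoid = record
        { isSemigroup = record
          { isMagma = record
            { isEquivalence = Setoid.isEquivalence (A².setoid ×ₛ ≡.setoid Bool)
            ; ∙-cong = λ { {_ , e} (p , refl) (q , refl) → A².∙-cong p (swapIf-cong e q) , refl }
            }
          ; assoc = λ (u , e) (v , f) (w , g) → assoc u e v f w , Bool.xor-assoc e f g
          }
        ; identity = (λ (u , _) → A².identityˡ u , refl)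
                   , (λ { (u , false) → A².identityʳ u , refl ; (u , true) → A².identityʳ u , refl })
        }
      ; inverse = (λ { (u , false) → A².inverseˡ u , refl
                     ; ((a , b) , true) → A².inverseˡ (b , a) , refl })
                , (λ { (u , false) → A².inverseʳ u , refl
                     ; (u , true)  → A².inverseʳ u , refl })
      ; ⁻¹-cong = λ { {_ , e} (p , refl) → swapIf-cong e (A².⁻¹-cong p) , refl }
      }
    }
    where
    -- The swap is an automorphism of order two. Both facts hold by computation once enough of the
    -- Booleans are known, which leaves associativity in the base group.
    assoc : ∀ u e v f w → (u A².∙ swapIf e v) A².∙ swapIf (e xor f) w
                    A².≈ u A².∙ swapIf e (v A².∙ swapIf f w)
    assoc u false v f     w = A².assoc u v (swapIf f w)
    assoc u true  v false w = A².assoc u (swapIf true v) (swapIf true w)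
    assoc u true  v true  w = A².assoc u (swapIf true v) w

  size : ∀ {n} → HasSize A.setoid n → HasSize (Group.setoid group) (n * n * 2)
  size s = ×-size (×-size s s) (Symmetry.inverse Fin.2↔Bool)
    where
    ×-size : ∀ {S T m k} → HasSize S m → HasSize T k → HasSize (S ×ₛ T) (m * k)
    ×-size s t = Compose.inverse (s ×-inverse t)
      (Compose.inverse Pointwise-≡↔≡ (Symmetry.inverse Fin.*↔×))

-- Decidable certificates in the wreath product

module _ (n : ℕ) .{{_ : NonZero n}} (inner outer : List (ℕ × ℕ)) where

  private
    module C = Cyclic n
    module W = Wreath C.group
    open Group W.group using (Carrier; _≈_; ε; _⁻¹)

    _≟_ : Decidable _≈_
    _≟_ = ×-decidable (×-decidable C._≈?_ C._≈?_) Bool._≟_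

  -- `inner` gives the generators in the base group, `outer` those in its nontrivial coset.
  generators : List Carrier
  generators = map (_, false) inner ++ map (_, true) outer

  open Connection W.group _≟_ generators
  open DecMembership decSetoid using (_∈_; _∉_; _∈?_; _∉?_)
  open DecUnique decSetoid using (Unique; unique?)

  -- Membership is up to congruence, so the n standard residues stand for all second coordinates.
  Hits : List Carrier → ℕ → Set
  Hits ws a = ∀ (j : Fin n) → ((a , toℕ j) , false) ∈ ws × ((a , toℕ j) , true) ∈ ws

  hits? : ∀ ws a → Dec (Hits ws a)
  hits? ws a = Fin.all? λ _ → (_ ∈? ws) ×-dec (_ ∈? ws)

  inFibre? : ∀ a (w : Carrier) → Dec (a C.≈ proj₁ (proj₁ w))
  inFibre? a w = a C.≈? proj₁ (proj₁ w)

  fibre : List Carrier → ℕ → List Carrier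
  fibre ws a = filter (inFibre? a) ws

  -- Only the products in the fibre over the first coordinate are searched. The list of
  -- products is an argument so that the evaluator shares it between the fibres.
  Covered : List Carrier → Set
  Covered ws = ∀ (i : Fin n) → Hits (fibre ws (toℕ i)) (toℕ i)

  covered? : ∀ ws → Dec (Covered ws)
  covered? ws = Fin.all? λ i → hits? (fibre ws (toℕ i)) (toℕ i)

  Certificate : Set
  Certificate =
      Unique (ε ∷ generators)
    × All (λ x → x ⁻¹ ∈ generators) generators
    -- The search for a missed element is confined to n candidates. This is enough, since each
    -- `inner` list below has at most one entry with first coordinate 0.
    × (∃ λ (i : Fin n) → ((0 , toℕ i) , false) ∉ ε ∷ generators)
    × Covered products

  certificate? : Dec Certificate
  certificate? =
          unique? (ε ∷ generators)
    ×-dec all? (λ x → x ⁻¹ ∈? generators) generators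
    ×-dec Fin.any? (λ _ → _ ∉? (ε ∷ generators))
    ×-dec covered? products

  -- For concrete lists `True certificate?` evaluates to the unit type, so the implicit argument is
  -- filled by η and type checking carries out the verification.
  cayleyOrder-wreath : {True certificate?} → CayleyOrder (length generators) (n * n * 2)
  cayleyOrder-wreath {t} with unique , closed , (_ , missed) , covered ← toWitness t =
    cayleyOrder spans (W.size C.size)
    where
    reduced : ∀ a → toℕ (a mod n) C.≈ a
    reduced a = Inverse.strictlyInverseʳ C.size a

    reached : ∀ v → v ∈ products
    -- Both coordinates are replaced by their standard residues, for which the certificate speaks;
    -- then the restriction to a fibre is dropped.
    reached ((a , b) , e) = ∈-resp-≈ (Group.setoid W.group) ((reduced a , reduced b) , refl)
      (filter⁻ (inFibre? (toℕ (a mod n))) (pick e (covered (a mod n) (b mod n))))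
      where
      pick : ∀ e {u ws} → (u , false) ∈ ws × (u , true) ∈ ws → (u , e) ∈ ws
      pick false = proj₁
      pick true  = proj₂

    spans : Spans
    spans = record
      { unique = unique ; inverse-closed = closed ; missed = _ , missed ; reached = reached }

-- The ten connection sets

C16≥200 : C⟨ 16 ,2⟩ ≥ 200
C16≥200 = order≤C (cayleyOrder-wreath 10
  -- In the base group (a , b) inverts to (-a , -b), which preserves a + b ≡ n / 2 because n / 2 ≡
  -- -n / 2. The entry (5 , 0) is an involution.
  ((1 , 4) ∷ (2 , 3) ∷ (5 , 0) ∷ (8 , 7) ∷ (9 , 6) ∷ [])
  -- In the other coset (a , b) inverts to (-b , -a), so an entry is an involution exactly when a +
  -- b ≡ 0, as for (2 , 8).
  ((2 , 3) ∷ (2 , 5) ∷ (2 , 8) ∷ (3 , 1) ∷ (3 , 5) ∷ (5 , 7) ∷ (5 , 8) ∷ (7 , 2) ∷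
   (7 , 8) ∷ (8 , 3) ∷ (9 , 7) ∷ []))

C21≥288 : C⟨ 21 ,2⟩ ≥ 288
C21≥288 = order≤C (cayleyOrder-wreath 12
  ((1 , 5) ∷ (3 , 3) ∷ (4 , 2) ∷ (6 , 0) ∷ (8 , 10) ∷ (9 , 9) ∷ (11 , 7) ∷ [])
  ((0 , 9) ∷ (1 , 4) ∷ (1 , 5) ∷ (1 , 11) ∷ (3 , 0) ∷ (3 , 8) ∷ (3 , 9) ∷ (4 , 6) ∷
   (4 , 9) ∷ (6 , 8) ∷ (7 , 1) ∷ (7 , 11) ∷ (8 , 11) ∷ (11 , 5) ∷ []))

C23≥392 : C⟨ 23 ,2⟩ ≥ 392
C23≥392 = order≤C (cayleyOrder-wreath 14
  ((0 , 7) ∷ (1 , 6) ∷ (4 , 3) ∷ (5 , 2) ∷ (9 , 12) ∷ (10 , 11) ∷ (13 , 8) ∷ [])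
  ((0 , 1) ∷ (0 , 8) ∷ (0 , 12) ∷ (2 , 0) ∷ (4 , 3) ∷ (5 , 9) ∷ (6 , 0) ∷ (6 , 8) ∷
   (8 , 1) ∷ (9 , 1) ∷ (10 , 1) ∷ (11 , 10) ∷ (13 , 0) ∷ (13 , 4) ∷ (13 , 5) ∷ (13 , 6) ∷ []))

C28≥512 : C⟨ 28 ,2⟩ ≥ 512
C28≥512 = order≤C (cayleyOrder-wreath 16
  ((2 , 6) ∷ (3 , 5) ∷ (4 , 4) ∷ (7 , 1) ∷ (8 , 0) ∷ (9 , 15) ∷ (12 , 12) ∷ (13 , 11) ∷
   (14 , 10) ∷ [])
  ((0 , 7) ∷ (0 , 10) ∷ (0 , 14) ∷ (1 , 4) ∷ (2 , 0) ∷ (2 , 11) ∷ (4 , 10) ∷ (5 , 7) ∷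
   (5 , 14) ∷ (6 , 0) ∷ (6 , 2) ∷ (6 , 12) ∷ (9 , 0) ∷ (9 , 11) ∷ (12 , 15) ∷ (13 , 2) ∷
   (14 , 2) ∷ (14 , 3) ∷ (14 , 10) ∷ []))

C31≥648 : C⟨ 31 ,2⟩ ≥ 648
C31≥648 = order≤C (cayleyOrder-wreath 18
  ((0 , 9) ∷ (1 , 8) ∷ (2 , 7) ∷ (4 , 5) ∷ (6 , 3) ∷ (12 , 15) ∷ (14 , 13) ∷ (16 , 11) ∷
   (17 , 10) ∷ [])
  ((0 , 0) ∷ (0 , 9) ∷ (2 , 3) ∷ (3 , 7) ∷ (4 , 8) ∷ (5 , 2) ∷ (7 , 8) ∷ (9 , 0) ∷
   (9 , 7) ∷ (9 , 8) ∷ (10 , 9) ∷ (10 , 11) ∷ (10 , 14) ∷ (11 , 9) ∷ (11 , 15) ∷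
   (12 , 4) ∷ (13 , 1) ∷ (14 , 6) ∷ (15 , 16) ∷ (16 , 13) ∷ (17 , 1) ∷ (17 , 5) ∷ []))

C37≥800 : C⟨ 37 ,2⟩ ≥ 800
C37≥800 = order≤C (cayleyOrder-wreath 20
  -- Two inverse pairs leave the line a + b ≡ 10: (3 , 8) with (17 , 12), and (7 , 2) with (13 ,
  -- 18). Their sums are 11 or 9 modulo 20.
  ((1 , 9) ∷ (3 , 7) ∷ (3 , 8) ∷ (4 , 6) ∷ (7 , 2) ∷ (8 , 2) ∷ (12 , 18) ∷ (13 , 18) ∷
   (16 , 14) ∷ (17 , 12) ∷ (17 , 13) ∷ (19 , 11) ∷ [])
  ((0 , 10) ∷ (1 , 9) ∷ (2 , 1) ∷ (2 , 18) ∷ (3 , 6) ∷ (4 , 10) ∷ (4 , 15) ∷ (5 , 5) ∷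
   (5 , 16) ∷ (6 , 10) ∷ (6 , 12) ∷ (7 , 1) ∷ (7 , 8) ∷ (8 , 14) ∷ (10 , 0) ∷ (10 , 14) ∷
   (10 , 16) ∷ (11 , 19) ∷ (12 , 1) ∷ (12 , 13) ∷ (14 , 17) ∷ (15 , 15) ∷ (19 , 8) ∷
   (19 , 13) ∷ (19 , 18) ∷ []))

C40≥968 : C⟨ 40 ,2⟩ ≥ 968
C40≥968 = order≤C (cayleyOrder-wreath 22
  -- Here the first coordinates fill the interval from 6 to 16, symmetric about the involution (11 ,
  -- 0).
  ((6 , 5) ∷ (7 , 4) ∷ (8 , 3) ∷ (9 , 2) ∷ (10 , 1) ∷ (11 , 0) ∷ (12 , 21) ∷ (13 , 20) ∷
   (14 , 19) ∷ (15 , 18) ∷ (16 , 17) ∷ [])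
  ((1 , 10) ∷ (2 , 4) ∷ (4 , 14) ∷ (4 , 16) ∷ (5 , 3) ∷ (5 , 4) ∷ (6 , 6) ∷ (6 , 11) ∷
   (6 , 18) ∷ (7 , 14) ∷ (8 , 1) ∷ (8 , 5) ∷ (8 , 15) ∷ (8 , 18) ∷ (10 , 1) ∷ (11 , 16) ∷
   (12 , 21) ∷ (13 , 6) ∷ (14 , 1) ∷ (16 , 9) ∷ (16 , 16) ∷ (17 , 14) ∷ (18 , 17) ∷
   (18 , 20) ∷ (19 , 17) ∷ (21 , 1) ∷ (21 , 8) ∷ (21 , 12) ∷ (21 , 14) ∷ []))

C46≥1152 : C⟨ 46 ,2⟩ ≥ 1152
C46≥1152 = order≤C (cayleyOrder-wreath 24
  ((0 , 12) ∷ (1 , 11) ∷ (6 , 6) ∷ (7 , 5) ∷ (8 , 4) ∷ (9 , 3) ∷ (10 , 2) ∷ (14 , 22) ∷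
   (15 , 21) ∷ (16 , 20) ∷ (17 , 19) ∷ (18 , 18) ∷ (23 , 13) ∷ [])
  ((0 , 3) ∷ (0 , 15) ∷ (1 , 11) ∷ (1 , 13) ∷ (1 , 21) ∷ (2 , 18) ∷ (3 , 16) ∷ (3 , 23) ∷
   (5 , 1) ∷ (5 , 8) ∷ (5 , 14) ∷ (6 , 1) ∷ (6 , 22) ∷ (8 , 2) ∷ (8 , 21) ∷ (9 , 0) ∷
   (10 , 6) ∷ (10 , 19) ∷ (11 , 23) ∷ (12 , 3) ∷ (12 , 8) ∷ (12 , 12) ∷ (13 , 23) ∷
   (16 , 12) ∷ (16 , 19) ∷ (18 , 14) ∷ (20 , 3) ∷ (21 , 0) ∷ (21 , 4) ∷ (21 , 12) ∷
   (22 , 16) ∷ (23 , 18) ∷ (23 , 19) ∷ []))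

C49≥1352 : C⟨ 49 ,2⟩ ≥ 1352
C49≥1352 = order≤C (cayleyOrder-wreath 26
  ((2 , 11) ∷ (3 , 10) ∷ (4 , 9) ∷ (6 , 7) ∷ (8 , 5) ∷ (12 , 1) ∷ (13 , 0) ∷ (14 , 25) ∷
   (18 , 21) ∷ (20 , 19) ∷ (22 , 17) ∷ (23 , 16) ∷ (24 , 15) ∷ [])
  ((0 , 1) ∷ (2 , 5) ∷ (3 , 20) ∷ (3 , 21) ∷ (3 , 23) ∷ (4 , 16) ∷ (5 , 10) ∷ (5 , 13) ∷
   (5 , 23) ∷ (6 , 3) ∷ (6 , 23) ∷ (7 , 5) ∷ (7 , 6) ∷ (7 , 14) ∷ (8 , 13) ∷ (8 , 18) ∷
   (10 , 6) ∷ (10 , 22) ∷ (11 , 1) ∷ (12 , 19) ∷ (13 , 18) ∷ (13 , 21) ∷ (15 , 7) ∷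
   (16 , 9) ∷ (16 , 21) ∷ (17 , 6) ∷ (17 , 10) ∷ (19 , 11) ∷ (20 , 9) ∷ (20 , 16) ∷
   (20 , 19) ∷ (21 , 19) ∷ (21 , 24) ∷ (23 , 20) ∷ (25 , 0) ∷ (25 , 15) ∷ []))

C54≥1568 : C⟨ 54 ,2⟩ ≥ 1568
C54≥1568 = order≤C (cayleyOrder-wreath 28
  ((1 , 13) ∷ (3 , 11) ∷ (4 , 10) ∷ (5 , 9) ∷ (6 , 8) ∷ (7 , 7) ∷ (12 , 2) ∷ (14 , 0) ∷
   (16 , 26) ∷ (21 , 21) ∷ (22 , 20) ∷ (23 , 19) ∷ (24 , 18) ∷ (25 , 17) ∷ (27 , 15) ∷ [])
  ((1 , 14) ∷ (1 , 20) ∷ (1 , 22) ∷ (3 , 6) ∷ (4 , 6) ∷ (5 , 12) ∷ (5 , 22) ∷ (6 , 6) ∷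
   (6 , 14) ∷ (6 , 23) ∷ (6 , 27) ∷ (7 , 3) ∷ (7 , 21) ∷ (8 , 6) ∷ (8 , 27) ∷ (10 , 5) ∷
   (12 , 14) ∷ (14 , 11) ∷ (14 , 16) ∷ (14 , 22) ∷ (14 , 27) ∷ (15 , 9) ∷ (16 , 9) ∷
   (16 , 23) ∷ (17 , 7) ∷ (17 , 14) ∷ (19 , 12) ∷ (19 , 13) ∷ (20 , 2) ∷ (21 , 11) ∷
   (22 , 20) ∷ (22 , 22) ∷ (22 , 24) ∷ (22 , 25) ∷ (23 , 18) ∷ (25 , 1) ∷ (25 , 21) ∷
   (26 , 8) ∷ (27 , 3) ∷ []))

theorem2 : (C⟨ 16 ,2⟩ ≥ 200) ×
    (C⟨ 21 ,2⟩ ≥ 288) ×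
    (C⟨ 23 ,2⟩ ≥ 392) ×
    (C⟨ 28 ,2⟩ ≥ 512) ×
    (C⟨ 31 ,2⟩ ≥ 648) ×
    (C⟨ 37 ,2⟩ ≥ 800) ×
    (C⟨ 40 ,2⟩ ≥ 968) ×
    (C⟨ 46 ,2⟩ ≥ 1152) ×
    (C⟨ 49 ,2⟩ ≥ 1352) ×
    (C⟨ 54 ,2⟩ ≥ 1568)
theorem2 =
  C16≥200 ,
  C21≥288 ,
  C23≥392 ,
  C28≥512 ,
  C31≥648 ,
  C37≥800 ,
  C40≥968 ,
  C46≥1152 ,
  C49≥1352 ,
  C54≥1568
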